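{- Let $q$ be a prime power and suppose there exists a linear $(t_i,t_o,s,q)$-AONT with $2\le t_i\le t_o$. Then \[ s\le \frac{(t_o-1)(q^{t_i}-1)}{(t_i-1)(q-1)}.\]
   Context: A linear $(t_i,t_o,s,q)$-AONT is given by an invertible $s\times s$ matrix $M$ over $\mathbb{F}_q$ defining the map $\mathbf{x}\mapsto\mathbf{y}=\mathbf{x}M^{ -1}$ on row vectors of $\mathbb{F}_q^s$, such that for every set $I$ of $t_i$ input coordinates and every set $J$ of $s-t_o$ output coordinates, the pair $((x_i)_{i\in I},(y_j)_{j\in J})$ takes every value in $\mathbb{F}_q^{t_i+s-t_o}$ equally often as $\mathbf{x}$ ranges over $\mathbb{F}_q^s$. Equivalently, $M$ is invertible and every $t_o\times t_i$ submatrix of $M$ has rank $t_i$. -}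

module Defs where

open import Algebra.Bundles using (CommutativeRing)
open import Algebra.Structures using (IsCommutativeRing)
import Algebra.Properties.Monoid.Sum as MonoidSum
open import Data.Bool.Base using (true; false; if_then_else_)
open import Data.Fin.Base using (Fin)
import Data.Fin.Properties as Fin
open import Data.Fin.Subset using (Subset; ∣_∣)
open import Data.Nat.Base using (ℕ; suc; _+_; _*_; _∸_; _^_; _≤_; _<_; NonZero; >-nonZero; nonTrivial⇒n>1)
open import Data.Nat.Primality using (Prime; prime⇒nonTrivial; prime⇒nonZero)
open import Data.Nat.Properties using (m*n≢0; ≤-trans; m≤m*n; m^n≢0; m<n⇒0<n∸m)
open import Data.Product.Base using (∃-syntax; _×_; _,_)
open import Data.Vec.Base using (Vec; []; _∷_; lookup; tabulate)
open import Function.Bundles using (_↔_)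
open import Level using (0ℓ)
open import Relation.Binary.PropositionalEquality using (_≡_; _≢_; refl)
open import Relation.Nullary.Decidable using (does)

IsPrimePower : ℕ → Set
IsPrimePower q = ∃[ p ] ∃[ k ] (Prime p × 1 ≤ k × q ≡ p ^ k)

record FiniteField (q : ℕ) : Set₁ where
  infixl 6 _⊕_
  infixl 7 _⊗_
  field
    Carrier           : Set
    _⊕_ _⊗_           : Carrier → Carrier → Carrier
    ⊖_                : Carrier → Carrier
    0# 1#             : Carrier
    isCommutativeRing : IsCommutativeRing _≡_ _⊕_ _⊗_ ⊖_ 0# 1#
    0≢1               : 0# ≢ 1#
    invertible        : ∀ x → x ≢ 0# → ∃[ y ] x ⊗ y ≡ 1#
    enumeration       : Carrier ↔ Fin q

  commutativeRing : CommutativeRing 0ℓ 0ℓ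
  commutativeRing = record { isCommutativeRing = isCommutativeRing }

restrict : ∀ {A : Set} {n} (I : Subset n) → Vec A n → Vec A ∣ I ∣
restrict []          []       = []
restrict (true  ∷ I) (x ∷ xs) = x ∷ restrict I xs
restrict (false ∷ I) (x ∷ xs) = restrict I xs

-- A function between finite sets takes every value equally often: all its
-- fibres have the same number k of elements.
TakesEveryValueEquallyOften : {A B : Set} → (A → B) → Set
TakesEveryValueEquallyOften {A} {B} f =
  ∃[ k ] ((b : B) → (∃[ a ] f a ≡ b) ↔ Fin k)

module _ {q : ℕ} (F : FiniteField q) where
  open FiniteField F
  open MonoidSum (CommutativeRing.+-monoid commutativeRing) using (sum)

  Matrix : ℕ → ℕ → Set
  Matrix m n = Fin m → Fin n → Carrier

  identityMatrix : ∀ {n} → Matrix n n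
  identityMatrix i j = if does (i Fin.≟ j) then 1# else 0#

  matMul : ∀ {l m n} → Matrix l m → Matrix m n → Matrix l n
  matMul M N i j = sum (λ k → M i k ⊗ N k j)

  vecMul : ∀ {m n} → Vec Carrier m → Matrix m n → Vec Carrier n
  vecMul x M = tabulate (λ j → sum (λ i → lookup x i ⊗ M i j))

  record IsInverse {n} (M N : Matrix n n) : Set where
    field
      inverseʳ : ∀ i j → matMul M N i j ≡ identityMatrix i j
      inverseˡ : ∀ i j → matMul N M i j ≡ identityMatrix i j

  -- ∣ J ∣ + tₒ ≡ s says ∣ J ∣ = s - tₒ without truncated subtraction.
  record LinearAONT (tᵢ tₒ s : ℕ) : Set where
    field
      M         : Matrix s s
      M⁻¹       : Matrix s s
      isInverse : IsInverse M M⁻¹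
      unbiased  : (I J : Subset s) → ∣ I ∣ ≡ tᵢ → ∣ J ∣ + tₒ ≡ s →
                  TakesEveryValueEquallyOften
                    (λ (x : Vec Carrier s) → restrict I x , restrict J (vecMul x M⁻¹))

primePower>1 : ∀ {q} → IsPrimePower q → 1 < q
primePower>1 (p , suc k , p-prime , _ , refl) =
  ≤-trans (nonTrivial⇒n>1 p {{prime⇒nonTrivial p-prime}})
          (m≤m*n p (p ^ k) {{m^n≢0 p k {{prime⇒nonZero p-prime}}}})

denominator≢0 : ∀ {t q} → 2 ≤ t → IsPrimePower q → NonZero ((t ∸ 1) * (q ∸ 1))
denominator≢0 {t} {q} 2≤t q-pp =
  m*n≢0 (t ∸ 1) (q ∸ 1)
    {{>-nonZero (m<n⇒0<n∸m 2≤t)}} {{>-nonZero (m<n⇒0<n∸m (primePower>1 q-pp))}}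

{-# OPTIONS --safe #-}

-- Let t = tᵢ, c = tₒ - 1 and keep the first t columns of M.  For a nonzero a in F^t at most c of
-- the s rows m satisfy ⟨a , m⟩ = 0: given tₒ such rows, let J be the complement of their index
-- set; by unbiasedness some x has ⟨a , x⟩ = 1 on the first t coordinates and y = x M⁻¹ zero on J,
-- but x = y M gives ⟨a , x⟩ = Σⱼ yⱼ ⟨a , mⱼ⟩ = 0.  Conversely each row is orthogonal to at least
-- q^(t-1) vectors a.  Counting the orthogonal pairs (a , m) in both ways, where a = 0 contributes
-- s, yields s (q^(t-1) - 1) ≤ c (q^t - 1), and (t-1)(q-1) ≤ q^(t-1) - 1 by Bernoulli.
module Submission where

open import Defs
open import Algebra.Bundles using (CommutativeRing)
import Algebra.Properties.Semiring.Sum as SemiringSum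
open import Data.Bool.Base using (Bool; true; false)
open import Data.Fin.Base using (Fin; zero; suc; _↑ˡ_; punchIn)
import Data.Fin.Properties as Fin
open import Data.Fin.Subset using (Subset; ∣_∣; _∈_; _⊆_; ∁; inside; outside)
open import Data.Fin.Subset.Properties using (_∈?_; ∣∁p∣≡n∸∣p∣; ∣p∣≤n; x∉∁p⇒x∈p; out⊆; s⊆s)
open import Data.Nat.Base using (ℕ; zero; suc; z≤n; s≤s; _+_; _*_; _∸_; _^_; NonZero; >-nonZero) renaming (_≤_ to _≤ℕ_; _<_ to _<ℕ_)
import Data.Nat.Properties as ℕ
open import Data.Nat.Tactic.RingSolver using (solve-∀)
open import Data.Integer.Base using (+_; +≤+) renaming (_≤_ to _≤ℤ_)
import Data.Integer.Properties as ℤ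
open import Data.Product.Base using (∃-syntax; _×_; _,_; proj₁; proj₂)
open import Data.Rational.Unnormalised.Base using (_/_; _≤_; *≤*)
open import Data.Vec.Base using (Vec; []; _∷_; _++_; here; there; lookup; tabulate; replicate)
open import Data.Vec.Properties using (∷-injective; lookup-++ˡ; lookup-replicate; lookup∘tabulate; []=⇒lookup)
open import Function.Base using (_∘_)
open import Function.Bundles using (module Inverse)
open import Function.Properties.Inverse using (↔⇒↣)
open import Relation.Binary.Definitions using (DecidableEquality)
open import Relation.Binary.PropositionalEquality
open import Relation.Nullary.Decidable using (Dec; does; yes; no; dec-true; via-injection)
open import Relation.Nullary.Negation using (contradiction)

module ∑ = SemiringSum ℕ.+-*-semiring

-- Indicators and finite sums of natural numbers.

does≡true⇒ : {P : Set} (P? : Dec P) → does P? ≡ true → P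
does≡true⇒ (yes p) _ = p

bit : Bool → ℕ
bit true  = 1
bit false = 0

bit≤1 : ∀ b → bit b ≤ℕ 1
bit≤1 true  = ℕ.≤-refl
bit≤1 false = z≤n

sum-mono : ∀ {n} {f g : Fin n → ℕ} → (∀ i → f i ≤ℕ g i) → ∑.sum f ≤ℕ ∑.sum g
sum-mono {zero}  f≤g = z≤n
sum-mono {suc n} f≤g = ℕ.+-mono-≤ (f≤g zero) (sum-mono (f≤g ∘ suc))

sum-const : ∀ n c → ∑.sum {n} (λ _ → c) ≡ n * c
sum-const zero    c = refl
sum-const (suc n) c = cong (λ m → c + m) (sum-const n c)

sum-bounded : ∀ {n} (f : Fin n → ℕ) c → (∀ i → f i ≤ℕ c) → ∑.sum f ≤ℕ n * c
sum-bounded {n} f c f≤c = ℕ.≤-trans (sum-mono f≤c) (ℕ.≤-reflexive (sum-const n c))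

term≤sum : ∀ {n} (f : Fin n → ℕ) i → f i ≤ℕ ∑.sum f
term≤sum f zero    = ℕ.m≤m+n _ _
term≤sum f (suc i) = ℕ.≤-trans (term≤sum (f ∘ suc) i) (ℕ.m≤n+m _ _)

-- The exceptional term is split off and each of the others is bounded by `c`. Adding `c` on the
-- left avoids writing n - 1 on the right.
sum-bounded-except : ∀ {n} (f : Fin n → ℕ) c i → (∀ j → j ≢ i → f j ≤ℕ c) →
                     ∑.sum f + c ≤ℕ n * c + f i
sum-bounded-except {suc n} f c i f≤c = begin
  ∑.sum f + c                            ≡⟨ cong (_+ c) (∑.sum-remove {i = i} f) ⟩
  f i + ∑.sum (λ j → f (punchIn i j)) + c ≤⟨ ℕ.+-monoˡ-≤ c (ℕ.+-monoʳ-≤ (f i) (sum-bounded _ c λ j → f≤c _ (Fin.punchInᵢ≢i i j))) ⟩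
  f i + n * c + c                        ≡⟨ rearrange (f i) (n * c) c ⟩
  suc n * c + f i                        ∎
  where
  open ℕ.≤-Reasoning
  rearrange : ∀ x y z → x + y + z ≡ z + y + x
  rearrange = solve-∀

-- Subsets, restrictions and fibres.

∣tabulate∣ : ∀ {n} (f : Fin n → Bool) → ∣ tabulate f ∣ ≡ ∑.sum (λ i → bit (f i))
∣tabulate∣ {zero}  f = refl
∣tabulate∣ {suc n} f with f zero
... | true  = cong suc (∣tabulate∣ (f ∘ suc))
... | false = ∣tabulate∣ (f ∘ suc)

-- Trims a set of at least `tₒ` orthogonal rows to exactly `tₒ`, the only size whose complement
-- unbiasedness speaks of.
subset-of-size : ∀ {n} (Z : Subset n) m → m ≤ℕ ∣ Z ∣ → ∃[ K ] K ⊆ Z × ∣ K ∣ ≡ m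
subset-of-size []            zero    m≤ = [] , (λ x → x) , refl
subset-of-size (outside ∷ Z) m       m≤ =
  let K , K⊆Z , eq = subset-of-size Z m m≤ in outside ∷ K , out⊆ K⊆Z , eq
subset-of-size (inside ∷ Z)  zero    m≤ =
  let K , K⊆Z , eq = subset-of-size Z zero z≤n in outside ∷ K , out⊆ K⊆Z , eq
subset-of-size (inside ∷ Z)  (suc m) (s≤s m≤) =
  let K , K⊆Z , eq = subset-of-size Z m m≤ in inside ∷ K , s⊆s K⊆Z , cong suc eq

∣∁p∣+∣p∣≡n : ∀ {n} (p : Subset n) → ∣ ∁ p ∣ + ∣ p ∣ ≡ n
∣∁p∣+∣p∣≡n p = trans (cong (_+ ∣ p ∣) (∣∁p∣≡n∸∣p∣ p)) (ℕ.m∸n+n≡m (∣p∣≤n p))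

first : ∀ t r → Subset (t + r)
first t r = replicate t inside ++ replicate r outside

∣first∣ : ∀ t r → ∣ first t r ∣ ≡ t
∣first∣ zero    zero    = refl
∣first∣ zero    (suc r) = ∣first∣ zero r
∣first∣ (suc t) r       = cong suc (∣first∣ t r)

∈-first : ∀ {t} r (i : Fin t) → i ↑ˡ r ∈ first t r
∈-first r zero    = here
∈-first r (suc i) = there (∈-first r i)

restrict-≡⇒lookup-≡ : ∀ {A : Set} {n} {I : Subset n} {x y : Vec A n} {i} →
                      restrict I x ≡ restrict I y → i ∈ I → lookup x i ≡ lookup y i
restrict-≡⇒lookup-≡ {x = _ ∷ _} {_ ∷ _} eq here = proj₁ (∷-injective eq)
restrict-≡⇒lookup-≡ {I = inside  ∷ _} {_ ∷ _} {_ ∷ _} eq (there i∈I) =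
  restrict-≡⇒lookup-≡ (proj₂ (∷-injective eq)) i∈I
restrict-≡⇒lookup-≡ {I = outside ∷ _} {_ ∷ _} {_ ∷ _} eq (there i∈I) =
  restrict-≡⇒lookup-≡ eq i∈I

-- The fibre over `f a` contains `a`, so the common fibre size is positive; the index of `a` there
-- names an element of any other fibre.
equallyOften⇒surjective : {A B : Set} {f : A → B} → TakesEveryValueEquallyOften f →
                          A → ∀ b → ∃[ a ] f a ≡ b
equallyOften⇒surjective {f = f} (k , fibre) a b =
  Inverse.from (fibre b) (Inverse.to (fibre (f a)) (a , refl))

-- Bernoulli's inequality and clearing of denominators.

bernoulli : ∀ p n → 1 + n * p ≤ℕ suc p ^ n
bernoulli p zero    = ℕ.≤-refl
bernoulli p (suc n) = begin
  1 + (p + n * p)           ≤⟨ ℕ.m≤m+n _ (p * (n * p)) ⟩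
  1 + (p + n * p) + p * (n * p) ≡⟨ expand p (n * p) ⟩
  suc p * (1 + n * p)       ≤⟨ ℕ.*-monoʳ-≤ (suc p) (bernoulli p n) ⟩
  suc p * suc p ^ n         ∎
  where
  open ℕ.≤-Reasoning
  expand : ∀ p m → 1 + (p + m) + p * m ≡ (1 + p) * (1 + m)
  expand = solve-∀

n[q∸1]≤q^n∸1 : ∀ {q} n → 1 ≤ℕ q → n * (q ∸ 1) ≤ℕ q ^ n ∸ 1
n[q∸1]≤q^n∸1 {suc p} n _ = ℕ.∸-monoˡ-≤ 1 (bernoulli p n)

≤⇒/≤/ : ∀ s N D .{{_ : NonZero D}} → s * D ≤ℕ N → (+ s) / 1 ≤ (+ N) / D
≤⇒/≤/ s N (suc d) sD≤N =
  *≤* (subst₂ _≤ℤ_ (ℤ.pos-* s (suc d)) (sym (ℤ.*-identityʳ (+ N))) (+≤+ sD≤N))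

-- Vectors and matrices over a finite field.

module LinearAlgebra {q : ℕ} (F : FiniteField q) where
  open FiniteField F
  open CommutativeRing commutativeRing
    using (+-identityˡ; +-identityʳ; -‿inverseˡ; *-assoc; *-comm; *-identityʳ; zeroˡ; zeroʳ; semiring)
  open SemiringSum semiring
    using (sum; sum-cong-≗; sum-replicate-zero; ∑-comm; *-distribˡ-sum; *-distribʳ-sum)
  open Inverse enumeration using (to; from; strictlyInverseˡ; strictlyInverseʳ)
  open ≡-Reasoning

  _≟_ : DecidableEquality Carrier
  _≟_ = via-injection (↔⇒↣ enumeration) Fin._≟_

  dot : ∀ {t} → Vec Carrier t → (Fin t → Carrier) → Carrier
  dot a r = sum (λ i → lookup a i ⊗ r i)

  0ᵛ : ∀ {t} → Vec Carrier t
  0ᵛ = replicate _ 0#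

  sum-zero : ∀ {n} (f : Fin n → Carrier) → (∀ i → f i ≡ 0#) → sum f ≡ 0#
  sum-zero {n} f f≡0 = trans (sum-cong-≗ f≡0) (sum-replicate-zero n)

  -- `b` is supported at the first nonzero coordinate of `a`, where it holds the inverse of that
  -- entry.
  nonzero⇒functional : ∀ {t} (a : Vec Carrier t) → a ≢ 0ᵛ → ∃[ b ] dot a (lookup b) ≡ 1#
  nonzero⇒functional []      a≢0 = contradiction refl a≢0
  nonzero⇒functional (c ∷ a) a≢0 with c ≟ 0#
  ... | yes refl =
    let b , eq = nonzero⇒functional a (a≢0 ∘ cong (0# ∷_))
    in 0# ∷ b , trans (cong₂ _⊕_ (zeroˡ 0#) eq) (+-identityˡ 1#)
  ... | no c≢0 =
    let d , cd≡1 = invertible c c≢0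
    in d ∷ 0ᵛ , trans (cong₂ _⊕_ cd≡1 (sum-zero (λ i → lookup a i ⊗ lookup 0ᵛ i) λ i →
                  trans (cong (lookup a i ⊗_) (lookup-replicate i 0#)) (zeroʳ _)))
                      (+-identityʳ 1#)

  dot-identityMatrix : ∀ {n} (x : Vec Carrier n) j → dot x (λ i → identityMatrix F i j) ≡ lookup x j
  dot-identityMatrix (c ∷ x) zero    =
    trans (cong₂ _⊕_ (*-identityʳ c) (sum-zero (λ i → lookup x i ⊗ 0#) λ i → zeroʳ _)) (+-identityʳ c)
  dot-identityMatrix (c ∷ x) (suc j) =
    trans (cong₂ _⊕_ (zeroʳ c) (dot-identityMatrix x j)) (+-identityˡ _)

  -- Associativity x(Au) = (xA)u, by exchanging the two sums.
  dot-matMul : ∀ {m n} (x : Vec Carrier m) (A : Matrix F m n) (u : Fin n → Carrier) →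
               dot x (λ i → sum (λ j → A i j ⊗ u j)) ≡ dot (vecMul F x A) u
  dot-matMul x A u = begin
    sum (λ i → lookup x i ⊗ sum (λ j → A i j ⊗ u j))
      ≡⟨ sum-cong-≗ (λ i → *-distribˡ-sum (lookup x i) (λ j → A i j ⊗ u j)) ⟩
    sum (λ i → sum (λ j → lookup x i ⊗ (A i j ⊗ u j)))
      ≡⟨ ∑-comm (λ i j → lookup x i ⊗ (A i j ⊗ u j)) ⟩
    sum (λ j → sum (λ i → lookup x i ⊗ (A i j ⊗ u j)))
      ≡⟨ sum-cong-≗ (λ j → sum-cong-≗ λ i → sym (*-assoc (lookup x i) (A i j) (u j))) ⟩
    sum (λ j → sum (λ i → lookup x i ⊗ A i j ⊗ u j))
      ≡⟨ sum-cong-≗ (λ j → sym (*-distribʳ-sum (u j) (λ i → lookup x i ⊗ A i j))) ⟩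
    sum (λ j → sum (λ i → lookup x i ⊗ A i j) ⊗ u j)
      ≡⟨ sum-cong-≗ (λ j → cong (_⊗ u j) (sym (lookup∘tabulate _ j))) ⟩
    dot (vecMul F x A) u ∎

  inverse-recovers : ∀ {n} {A B : Matrix F n n} → IsInverse F A B → ∀ x j →
                     dot (vecMul F x B) (λ i → A i j) ≡ lookup x j
  inverse-recovers {A = A} {B} inv x j = begin
    dot (vecMul F x B) (λ i → A i j)  ≡⟨ dot-matMul x B (λ i → A i j) ⟨
    dot x (λ i → matMul F B A i j)    ≡⟨ sum-cong-≗ (λ i → cong (lookup x i ⊗_) (IsInverse.inverseˡ inv i j)) ⟩
    dot x (λ i → identityMatrix F i j) ≡⟨ dot-identityMatrix x j ⟩
    lookup x j                        ∎

  -- Sums over all vectors of F^t.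

  ∑ᵛ : ∀ t → (Vec Carrier t → ℕ) → ℕ
  ∑ᵛ zero    f = f []
  ∑ᵛ (suc t) f = ∑.sum (λ k → ∑ᵛ t (λ v → f (from k ∷ v)))

  ∑ᵛ-mono : ∀ t {f g} → (∀ v → f v ≤ℕ g v) → ∑ᵛ t f ≤ℕ ∑ᵛ t g
  ∑ᵛ-mono zero    f≤g = f≤g []
  ∑ᵛ-mono (suc t) f≤g = sum-mono (λ k → ∑ᵛ-mono t (λ v → f≤g (from k ∷ v)))

  ∑ᵛ-cong : ∀ t {f g} → (∀ v → f v ≡ g v) → ∑ᵛ t f ≡ ∑ᵛ t g
  ∑ᵛ-cong zero    f≡g = f≡g []
  ∑ᵛ-cong (suc t) f≡g = ∑.sum-cong-≗ (λ k → ∑ᵛ-cong t (λ v → f≡g (from k ∷ v)))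

  ∑ᵛ-const : ∀ t c → ∑ᵛ t (λ _ → c) ≡ q ^ t * c
  ∑ᵛ-const zero    c = sym (ℕ.*-identityˡ c)
  ∑ᵛ-const (suc t) c = begin
    ∑.sum {q} (λ _ → ∑ᵛ t (λ _ → c)) ≡⟨ sum-const q _ ⟩
    q * ∑ᵛ t (λ _ → c)               ≡⟨ cong (q *_) (∑ᵛ-const t c) ⟩
    q * (q ^ t * c)                  ≡⟨ ℕ.*-assoc q (q ^ t) c ⟨
    q ^ suc t * c                    ∎

  ∑ᵛ-∑-comm : ∀ t {n} (g : Vec Carrier t → Fin n → ℕ) →
              ∑ᵛ t (λ v → ∑.sum (g v)) ≡ ∑.sum (λ j → ∑ᵛ t (λ v → g v j))
  ∑ᵛ-∑-comm zero    g = refl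
  ∑ᵛ-∑-comm (suc t) g = trans (∑.sum-cong-≗ (λ k → ∑ᵛ-∑-comm t (λ v → g (from k ∷ v))))
                              (∑.∑-comm (λ k j → ∑ᵛ t (λ v → g (from k ∷ v) j)))

  -- Vectors are sliced by their head: a slice with nonzero head avoids the zero vector and sums to
  -- at most q^t c, and the slice with head zero is handled by induction.
  ∑ᵛ-bounded-except-0 : ∀ t (f : Vec Carrier t → ℕ) c → (∀ v → v ≢ 0ᵛ → f v ≤ℕ c) →
                        ∑ᵛ t f + c ≤ℕ q ^ t * c + f 0ᵛ
  ∑ᵛ-bounded-except-0 zero    f c f≤c =
    ℕ.≤-reflexive (trans (ℕ.+-comm (f []) c) (cong (_+ f []) (sym (ℕ.*-identityˡ c))))
  -- Adding `outer` and `inner` leaves `C` and `G₀` on both sides, and both cancel.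
  ∑ᵛ-bounded-except-0 (suc t) f c f≤c = ℕ.+-cancelʳ-≤ C _ _ (ℕ.+-cancelʳ-≤ G₀ _ _ chain)
    where
    C = q ^ t * c
    G : Carrier → ℕ
    G x = ∑ᵛ t (λ v → f (x ∷ v))
    G₀ = G 0#
    S = ∑.sum (G ∘ from)
    outer : S + C ≤ℕ q * C + G (from (to 0#))
    outer = sum-bounded-except (G ∘ from) C (to 0#) λ k k≢0 →
      ℕ.≤-trans (∑ᵛ-mono t λ v → f≤c _ λ eq →
                   k≢0 (trans (sym (strictlyInverseˡ k)) (cong to (proj₁ (∷-injective eq)))))
                (ℕ.≤-reflexive (∑ᵛ-const t c))
    inner : G₀ + c ≤ℕ C + f 0ᵛ
    inner = ∑ᵛ-bounded-except-0 t (λ v → f (0# ∷ v)) c (λ v v≢0 → f≤c _ (v≢0 ∘ proj₂ ∘ ∷-injective))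
    rearrange₁ : ∀ S c C G → S + c + C + G ≡ (S + C) + (G + c)
    rearrange₁ = solve-∀
    rearrange₂ : ∀ Q G C f → (Q + G) + (C + f) ≡ Q + f + C + G
    rearrange₂ = solve-∀
    chain : S + c + C + G₀ ≤ℕ q ^ suc t * c + f 0ᵛ + C + G₀
    chain = subst₂ _≤ℕ_ (sym (rearrange₁ S c C G₀))
      (trans (rearrange₂ (q * C) G₀ C (f 0ᵛ))
             (cong (λ m → m + f 0ᵛ + C + G₀) (sym (ℕ.*-assoc q (q ^ t) c))))
      (ℕ.+-mono-≤ (subst (λ x → S + C ≤ℕ q * C + G x) (strictlyInverseʳ 0#) outer) inner)

  -- Counting the vectors orthogonal to a given row.

  orth : ∀ {t} → Vec Carrier t → (Fin t → Carrier) → ℕ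
  orth a r = bit (does (dot a r ≟ 0#))

  orth≡1 : ∀ {t} (a : Vec Carrier t) r → dot a r ≡ 0# → orth a r ≡ 1
  orth≡1 a r eq = cong bit (dec-true (dot a r ≟ 0#) eq)

  -- Multiplied by q so that the statement makes sense, and the induction starts, at t = 0.
  q^t≤q*#orth : ∀ t (r : Fin t → Carrier) → 1 ≤ℕ q → q ^ t ≤ℕ q * ∑ᵛ t (λ a → orth a r)
  q^t≤q*#orth zero    r 1≤q = subst (λ b → 1 ≤ℕ q * b) (sym (orth≡1 [] r refl))
                                (subst (1 ≤ℕ_) (sym (ℕ.*-identityʳ q)) 1≤q)
  q^t≤q*#orth (suc t) r 1≤q with r zero ≟ 0#
  -- The head of the vector is free, so the count for the tail is multiplied by q.
  ... | yes r₀≡0 = ℕ.*-monoʳ-≤ q (ℕ.≤-trans (q^t≤q*#orth t (r ∘ suc) 1≤q)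
      (ℕ.≤-reflexive (sym (trans (∑.sum-cong-≗ λ k → ∑ᵛ-cong t (λ v → cong (λ d → bit (does (d ≟ 0#))) (drop k v)))
                                 (sum-const q _)))))
    where
    drop : ∀ k v → dot (from k ∷ v) r ≡ dot v (r ∘ suc)
    drop k v = trans (cong (_⊕ dot v (r ∘ suc)) (trans (cong (from k ⊗_) r₀≡0) (zeroʳ _))) (+-identityˡ _)
  -- Each tail `v` is completed to an orthogonal vector by the head `root v`, so each of the q^t
  -- tails contributes at least 1.
  ... | no r₀≢0 = ℕ.*-monoʳ-≤ q (subst₂ _≤ℕ_
      (trans (∑ᵛ-const t 1) (ℕ.*-identityʳ _))
      (∑ᵛ-∑-comm t (λ v k → orth (from k ∷ v) r))
      (∑ᵛ-mono t λ v → ℕ.≤-trans (ℕ.≤-reflexive (sym (orth≡1 (from (to (root v)) ∷ v) r (solves v))))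
                                 (term≤sum (λ k → orth (from k ∷ v) r) (to (root v)))))
    where
    r₀⁻¹ = proj₁ (invertible (r zero) r₀≢0)
    root : Vec Carrier t → Carrier
    root v = (⊖ dot v (r ∘ suc)) ⊗ r₀⁻¹
    solves : ∀ v → dot (from (to (root v)) ∷ v) r ≡ 0#
    solves v = begin
      from (to (root v)) ⊗ r zero ⊕ d ≡⟨ cong (λ x → x ⊗ r zero ⊕ d) (strictlyInverseʳ (root v)) ⟩
      (⊖ d) ⊗ r₀⁻¹ ⊗ r zero ⊕ d       ≡⟨ cong (_⊕ d) (*-assoc (⊖ d) r₀⁻¹ (r zero)) ⟩
      (⊖ d) ⊗ (r₀⁻¹ ⊗ r zero) ⊕ d     ≡⟨ cong (λ x → (⊖ d) ⊗ x ⊕ d) (trans (*-comm r₀⁻¹ (r zero)) (proj₂ (invertible (r zero) r₀≢0))) ⟩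
      (⊖ d) ⊗ 1# ⊕ d                  ≡⟨ cong (_⊕ d) (*-identityʳ (⊖ d)) ⟩
      (⊖ d) ⊕ d                       ≡⟨ -‿inverseˡ d ⟩
      0#                              ∎
      where d = dot v (r ∘ suc)

  -- Rows of an AONT orthogonal to a nonzero vector.

  module _ {t tₒ r : ℕ} (T : LinearAONT F t tₒ (t + r)) where
    open LinearAONT T

    -- Writing s as t + r lets `_↑ˡ r` address the first t columns.
    row : Fin (t + r) → Fin t → Carrier
    row j i = M j (i ↑ˡ r)

    #orthogonalRows : Vec Carrier t → ℕ
    #orthogonalRows a = ∑.sum (λ j → orth a (row j))

    #orthogonalRows<tₒ : ∀ a → a ≢ 0ᵛ → #orthogonalRows a <ℕ tₒ
    #orthogonalRows<tₒ a a≢0 = ℕ.≰⇒> λ tₒ≤# →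
      let K , K⊆Z , ∣K∣≡tₒ = subset-of-size Z tₒ (subst (tₒ ≤ℕ_) (sym (∣tabulate∣ orthogonal)) tₒ≤#)
          b , ab≡1 = nonzero⇒functional a a≢0
          x , fx≡ = equallyOften⇒surjective
                      (unbiased (first t r) (∁ K) (∣first∣ t r)
                        (trans (cong (λ m → ∣ ∁ K ∣ + m) (sym ∣K∣≡tₒ)) (∣∁p∣+∣p∣≡n K)))
                      -- The leading `0ᵛ` only witnesses that the domain is inhabited. The padding
                      -- of `b` is arbitrary, since `first t r` discards it.
                      0ᵛ (restrict (first t r) (b ++ 0ᵛ) , restrict (∁ K) 0ᵛ)
          y = vecMul F x M⁻¹
          x≡b : ∀ i → lookup x (i ↑ˡ r) ≡ lookup b i
          x≡b i = trans (restrict-≡⇒lookup-≡ (cong proj₁ fx≡) (∈-first r i)) (lookup-++ˡ b 0ᵛ i)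
          vanishes : ∀ j → lookup y j ⊗ sum (λ i → row j i ⊗ lookup a i) ≡ 0#
          vanishes j = term j (cong proj₂ fx≡) K⊆Z
          ab≡0 : dot a (lookup b) ≡ 0#
          ab≡0 = begin
            sum (λ i → lookup a i ⊗ lookup b i)
              -- On the first t coordinates `b` agrees with x = yM, which expresses it as a
              -- combination of rows with coefficients `y`.
              ≡⟨ sum-cong-≗ (λ i → trans (*-comm _ _) (cong (_⊗ lookup a i) (trans (sym (x≡b i)) (sym (inverse-recovers isInverse x (i ↑ˡ r)))))) ⟩
            sum (λ i → dot y (λ j → row j i) ⊗ lookup a i)
              ≡⟨ sum-cong-≗ (λ i → cong (_⊗ lookup a i) (sym (lookup∘tabulate _ i))) ⟩
            dot (vecMul F y row) (lookup a)
              ≡⟨ dot-matMul y row (lookup a) ⟨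
            dot y (λ j → sum (λ i → row j i ⊗ lookup a i))
              ≡⟨ sum-zero _ vanishes ⟩
            0# ∎
      in 0≢1 (trans (sym ab≡0) ab≡1)
      where
      orthogonal : Fin (t + r) → Bool
      orthogonal j = does (dot a (row j) ≟ 0#)
      Z : Subset (t + r)
      Z = tabulate orthogonal
      term : ∀ {K : Subset (t + r)} {y : Vec Carrier (t + r)} j → restrict (∁ K) y ≡ restrict (∁ K) 0ᵛ →
             K ⊆ Z → lookup y j ⊗ sum (λ i → row j i ⊗ lookup a i) ≡ 0#
      -- Outside `K` the coefficient of row `j` is zero; inside `K` the row is orthogonal to `a`.
      term {K} {y} j y≡0 K⊆Z with j ∈? ∁ K
      ... | yes j∈∁K = trans (cong (_⊗ _) (trans (restrict-≡⇒lookup-≡ y≡0 j∈∁K) (lookup-replicate j 0#))) (zeroˡ _)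
      ... | no  j∉∁K = trans (cong (lookup y j ⊗_) (trans (sum-cong-≗ λ i → *-comm (row j i) (lookup a i)) aj≡0)) (zeroʳ _)
        where
        aj≡0 : dot a (row j) ≡ 0#
        aj≡0 = does≡true⇒ (dot a (row j) ≟ 0#)
          (trans (sym (lookup∘tabulate orthogonal j)) ([]=⇒lookup (K⊆Z (x∉∁p⇒x∈p j∉∁K))))

-- Double counting and the resulting bound.

module _ {q : ℕ} (F : FiniteField q) where
  open LinearAlgebra F

  -- Orthogonal pairs are counted by rows and by vectors, with n = tᵢ - 1 and c = tₒ - 1. The
  -- summands `c` and s on the two sides account for a = 0 without truncated subtraction.
  AONT-count : ∀ n c r → LinearAONT F (suc n) (suc c) (suc n + r) → 1 ≤ℕ q →
               (suc n + r) * (q ^ n) + c ≤ℕ q ^ suc n * c + (suc n + r)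
  AONT-count n c r T 1≤q = begin
    s * q ^ n + c                                         ≡⟨ cong (_+ c) (sum-const s (q ^ n)) ⟨
    -- The lower bound on orthogonal vectors has a factor q on both sides, which cancels.
    ∑.sum {s} (λ _ → q ^ n) + c                           ≤⟨ ℕ.+-monoˡ-≤ c (sum-mono λ j → ℕ.*-cancelˡ-≤ q (q^t≤q*#orth (suc n) (row T j) 1≤q)) ⟩
    ∑.sum (λ j → ∑ᵛ (suc n) (λ a → orth a (row T j))) + c ≡⟨ cong (_+ c) (∑ᵛ-∑-comm (suc n) (λ a j → orth a (row T j))) ⟨
    ∑ᵛ (suc n) (#orthogonalRows T) + c                    ≤⟨ ∑ᵛ-bounded-except-0 (suc n) (#orthogonalRows T) c (λ a a≢0 → ℕ.≤-pred (#orthogonalRows<tₒ T a a≢0)) ⟩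
    q ^ suc n * c + #orthogonalRows T 0ᵛ                  ≤⟨ ℕ.+-monoʳ-≤ (q ^ suc n * c) (sum-bounded (λ j → orth 0ᵛ (row T j)) 1 λ j → bit≤1 _) ⟩
    q ^ suc n * c + s * 1                                 ≡⟨ cong (λ m → q ^ suc n * c + m) (ℕ.*-identityʳ s) ⟩
    q ^ suc n * c + s                                     ∎
    where
    open ℕ.≤-Reasoning
    s = suc n + r
    instance
      _ : NonZero q
      _ = >-nonZero 1≤q

  AONT-bound : ∀ n c s → n ≤ℕ c → 1 ≤ℕ q → LinearAONT F (suc n) (suc c) s →
               s * (q ^ n ∸ 1) ≤ℕ c * (q ^ suc n ∸ 1)
  AONT-bound n c s n≤c 1≤q T with suc c ℕ.≤? s
  -- No admissible `J` exists here, but s ≤ c already gives the bound factor by factor.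
  ... | no s<tₒ = ℕ.*-mono-≤ (ℕ.≤-pred (ℕ.≰⇒> s<tₒ))
                    (ℕ.∸-monoˡ-≤ 1 (ℕ.m≤n*m (q ^ n) q {{>-nonZero 1≤q}}))
  ... | yes tₒ≤s with ℕ.m≤n⇒∃[o]m+o≡n (ℕ.≤-trans (s≤s n≤c) tₒ≤s)
  -- As tᵢ ≤ tₒ ≤ s, the size s splits as tᵢ + r.
  ...   | r , refl = begin
    s * (q ^ n ∸ 1)         ≡⟨ trans (ℕ.*-distribˡ-∸ s (q ^ n) 1) (cong (s * q ^ n ∸_) (ℕ.*-identityʳ s)) ⟩
    s * q ^ n ∸ s           ≤⟨ ℕ.m≤n+o⇒m∸n≤o _ s (ℕ.+-cancelʳ-≤ c _ _ (ℕ.≤-trans (AONT-count n c r T 1≤q) (ℕ.≤-reflexive regroup))) ⟩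
    c * q ^ suc n ∸ c       ≡⟨ trans (ℕ.*-distribˡ-∸ c (q ^ suc n) 1) (cong (c * q ^ suc n ∸_) (ℕ.*-identityʳ c)) ⟨
    c * (q ^ suc n ∸ 1)     ∎
    where
    open ℕ.≤-Reasoning
    -- Since c ≤ c q^(n+1), subtracting `c` and adding it back is exact.
    regroup : q ^ suc n * c + s ≡ s + (c * q ^ suc n ∸ c) + c
    regroup = trans (trans (ℕ.+-comm _ s) (cong (λ m → s + m) (trans (ℕ.*-comm (q ^ suc n) c)
                (sym (ℕ.m∸n+n≡m (ℕ.m≤m*n c (q ^ suc n) {{ℕ.m^n≢0 q (suc n) {{>-nonZero 1≤q}}}}))))))
              (sym (ℕ.+-assoc s _ c))

theoremT1 : (q : ℕ) (q-primePower : IsPrimePower q) (F : FiniteField q)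
    (tᵢ tₒ s : ℕ) (2≤tᵢ : 2 ≤ℕ tᵢ) (tᵢ≤tₒ : tᵢ ≤ℕ tₒ) →
    LinearAONT F tᵢ tₒ s →
    (+ s) / 1 ≤ _/_ (+ ((tₒ ∸ 1) * (q ^ tᵢ ∸ 1))) ((tᵢ ∸ 1) * (q ∸ 1)) {{denominator≢0 2≤tᵢ q-primePower}}
theoremT1 q q-primePower F (suc n) (suc c) s 2≤tᵢ (s≤s n≤c) T =
  -- Clearing the denominator leaves s n (q - 1) ≤ c (q^(n+1) - 1) over the naturals.
  ≤⇒/≤/ s (c * (q ^ suc n ∸ 1)) (n * (q ∸ 1)) {{denominator≢0 2≤tᵢ q-primePower}}
    (ℕ.≤-trans (ℕ.*-monoʳ-≤ s (n[q∸1]≤q^n∸1 n 1≤q))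
               (AONT-bound F n c s n≤c 1≤q T))
  where
  1≤q : 1 ≤ℕ q
  1≤q = ℕ.<⇒≤ (primePower>1 q-primePower)
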